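{- Let $p$ be an odd prime, let $v$ be an integer with $1<v<p-1$, let $g\in\{2,\dots,p-1\}$ be a primitive root modulo $p$, and let $t\ge 1$. For $z=(z(0),\dots,z(t-1))\in\{0,\dots,v-1\}^t$ let $$\lambda(z)=\#\{x\in\{0,1,\dots,p-2\}:\ (g^{x+\iota}\,\%\,p)\,\%\,v=z(\iota)\text{ for all }0\le\iota<t\}.$$ Write $p=q\,g^{t-1}+r$ with integers $q\ge 0$ and $0\le r<g^{t-1}$. Then for every $z\in\{0,\dots,v-1\}^t$, $$\left\lfloor \frac{g}{v}\right\rfloor^{t-1}\left\lfloor\frac{q}{v}\right\rfloor\ \le\ \lambda(z)\ \le\ \left\lceil\frac{g}{v}\right\rceil^{t-1}\left(\left\lfloor\frac{q}{v}\right\rfloor+1\right).$$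
   Context: For integers $x$ and $m\ge1$, $x\,\%\,m$ denotes the least nonnegative remainder of $x$ modulo $m$. Thus $\lambda(z)$ is the number of (cyclic) occurrences of the tuple $z$ in the periodic sequence $\big((g^{i}\,\%\,p)\,\%\,v\big)_{i}$ of period $p-1$. -}

module Defs where

open import Data.Fin.Base using (Fin; toℕ)
open import Data.Fin.Properties using (all?)
open import Data.List.Base using (filter; length; upTo)
open import Data.Nat.Base
open import Data.Nat.DivMod using (m≡m%n+[m/n]*n; m%n<n; m<n*o⇒m/o<n)
open import Data.Nat.Properties
open import Data.Vec.Functional using (Vector)
open import Relation.Binary.PropositionalEquality using (_≡_; _≢_)
open import Relation.Unary using (Decidable)

⌈_/_⌉ : (m n : ℕ) .{{_ : NonZero n}} → ℕ
⌈ m / n ⌉ = (m + pred n) / n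

-- The following two lemmas say that ⌈ m / n ⌉ is the least k with m ≤ k * n.

m≤⌈m/n⌉*n : ∀ m n .{{_ : NonZero n}} → m ≤ ⌈ m / n ⌉ * n
m≤⌈m/n⌉*n m n@(suc n-1) = +-cancelʳ-≤ n-1 m (⌈ m / n ⌉ * n) (begin
  m + n-1                                  ≡⟨ m≡m%n+[m/n]*n (m + n-1) n ⟩
  (m + n-1) % n + ⌈ m / n ⌉ * n            ≤⟨ +-monoˡ-≤ _ (s≤s⁻¹ (m%n<n (m + n-1) n)) ⟩
  n-1 + ⌈ m / n ⌉ * n                      ≡⟨ +-comm n-1 _ ⟩
  ⌈ m / n ⌉ * n + n-1                      ∎)
  where open ≤-Reasoning

⌈m/n⌉-least : ∀ m n k .{{_ : NonZero n}} → m ≤ k * n → ⌈ m / n ⌉ ≤ k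
⌈m/n⌉-least m n@(suc n-1) k m≤kn = s≤s⁻¹ (m<n*o⇒m/o<n {n = suc k} (begin-strict
  m + n-1      <⟨ +-mono-≤-< m≤kn (n<1+n n-1) ⟩
  k * n + n    ≡⟨ +-comm (k * n) n ⟩
  suc k * n    ∎))
  where open ≤-Reasoning

record HasOrder (n a d : ℕ) .{{_ : NonZero n}} : Set where
  field
    positive : 0 < d
    power≡1  : (a ^ d) % n ≡ 1 % n
    minimal  : ∀ {k} → 0 < k → k < d → (a ^ k) % n ≢ 1 % n

-- Meant for prime p only, where the unit group modulo p has p ∸ 1 elements.
PrimitiveRoot : (p g : ℕ) .{{_ : NonZero p}} → Set
PrimitiveRoot p g = HasOrder p g (p ∸ 1)

module _ (p v g : ℕ) .{{_ : NonZero p}} .{{_ : NonZero v}} {t : ℕ} (z : Vector (Fin v) t) where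

  OccursAt : ℕ → Set
  OccursAt x = ∀ (ι : Fin t) → ((g ^ (x + toℕ ι)) % p) % v ≡ toℕ (z ι)

  occursAt? : Decidable OccursAt
  occursAt? x = all? λ ι → ((g ^ (x + toℕ ι)) % p) % v ≟ toℕ (z ι)

  occurrences : ℕ
  occurrences = length (filter occursAt? (upTo (p ∸ 1)))

module Submission where

-- As x runs through 0, …, p − 2, the residue y = gˣ % p runs through 1, …, p − 1.  Put yᵢ = gⁱ y % p, so
-- that g yᵢ = yᵢ₊₁ + aᵢ p, where a₀, a₁, … are the base g digits of y / p.  As v is prime to p, the condition
-- yᵢ₊₁ ≡ z(i+1) (mod v), given yᵢ ≡ z(i), says exactly that aᵢ lies in a prescribed residue class modulo v; among
-- 0, …, g − 1 such a class has at least ⌊g / v⌋ and at most ⌈g / v⌉ members.  Once a₀, …, a₍ₜ₋₂₎ are chosen, y is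
-- confined to an interval of length p / gᵗ⁻¹, in which the condition y ≡ z(0) (mod v) has at least ⌊q / v⌋ and at
-- most ⌊q / v⌋ + 1 solutions.

open import Defs
open import Data.Fin.Base using (Fin; zero; suc; toℕ; fromℕ<; punchOut; combine; remQuot; finToFun; funToFin)
open import Data.Fin.Properties using (toℕ<n; toℕ-injective; toℕ-fromℕ<; fromℕ<-injective; any?; punchOut-injective; injective⇒≤; combine-remQuot; funToFin-finToFin)
import Data.Fin.Properties as Fin
open import Data.List.Base using (List; []; _∷_; length; lookup; upTo)
open import Data.List.Membership.Propositional using (_∈_)
open import Data.List.Membership.Propositional.Properties using (∈-lookup; ∈-filter⁺; ∈-filter⁻; ∈-upTo⁺; ∈-upTo⁻)
open import Data.List.Relation.Unary.All as All using ()
open import Data.List.Relation.Unary.AllPairs using (_∷_)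
open import Data.List.Relation.Unary.Any using (index)
open import Data.List.Relation.Unary.Any.Properties using (lookup-index)
open import Data.List.Relation.Unary.Unique.Propositional using (Unique)
open import Data.List.Relation.Unary.Unique.Propositional.Properties using (upTo⁺; filter⁺)
open import Data.Nat.Base using (ℕ; zero; suc; NonZero; _+_; _*_; _∸_; _^_; _/_; _%_; _≤_; _<_; z≤n; s≤s; z<s; s≤s⁻¹; ∣_-_∣; >-nonZero; >-nonZero⁻¹; nonTrivial⇒n>1)
open import Data.Nat.Coprimality using (Coprime; 1-coprimeTo; coprime-divisor; prime⇒coprime)
import Data.Nat.Coprimality as Coprimality
open import Data.Nat.Divisibility using (_∣_; divides; ∣-refl)
open import Data.Nat.DivMod
open import Data.Nat.Primality using (Prime; prime⇒nonTrivial)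
open import Data.Nat.Properties
open import Data.Nat.Tactic.RingSolver using (solve-∀)
open import Data.Product.Base using (_×_; _,_; ∃; proj₁; proj₂; uncurry)
open import Data.Sum.Base using (inj₁; inj₂)
open import Data.Vec.Functional using (Vector)
open import Function.Base using (_∘_)
open import Function.Definitions using (Injective)
open import Relation.Binary.Definitions using (tri<; tri≈; tri>)
open import Relation.Binary.PropositionalEquality using (_≡_; refl; sym; trans; cong; cong₂; subst; module ≡-Reasoning)
open import Relation.Nullary.Decidable using (yes; no)
open import Relation.Nullary.Negation using (¬_; contradiction)

-- Congruences

%-cong-+ : ∀ a b c d n .{{_ : NonZero n}} → a % n ≡ b % n → c % n ≡ d % n → (a + c) % n ≡ (b + d) % n
%-cong-+ a b c d n a≡b c≡d = begin
  (a + c) % n          ≡⟨ %-distribˡ-+ a c n ⟩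
  (a % n + c % n) % n  ≡⟨ cong₂ (λ k l → (k + l) % n) a≡b c≡d ⟩
  (b % n + d % n) % n  ≡⟨ %-distribˡ-+ b d n ⟨
  (b + d) % n          ∎
  where open ≡-Reasoning

%-cong-* : ∀ a b c d n .{{_ : NonZero n}} → a % n ≡ b % n → c % n ≡ d % n → (a * c) % n ≡ (b * d) % n
%-cong-* a b c d n a≡b c≡d = begin
  (a * c) % n              ≡⟨ %-distribˡ-* a c n ⟩
  ((a % n) * (c % n)) % n  ≡⟨ cong₂ (λ k l → (k * l) % n) a≡b c≡d ⟩
  ((b % n) * (d % n)) % n  ≡⟨ %-distribˡ-* b d n ⟨
  (b * d) % n              ∎
  where open ≡-Reasoning

-- Turns congruence into divisibility of the distance, where translation invariance and
-- `coprime-divisor` yield the cancellation laws.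
%≡⇒∣ : ∀ a b n .{{_ : NonZero n}} → a % n ≡ b % n → n ∣ ∣ a - b ∣
%≡⇒∣ a b n a≡b = divides ∣ a / n - b / n ∣ (begin
  ∣ a - b ∣                                            ≡⟨ cong₂ ∣_-_∣ (m≡m%n+[m/n]*n a n) (m≡m%n+[m/n]*n b n) ⟩
  ∣ a % n + a / n * n - b % n + b / n * n ∣            ≡⟨ cong (λ r → ∣ r + a / n * n - b % n + b / n * n ∣) a≡b ⟩
  ∣ b % n + a / n * n - b % n + b / n * n ∣            ≡⟨ ∣m+n-m+o∣≡∣n-o∣ (b % n) (a / n * n) (b / n * n) ⟩
  ∣ a / n * n - b / n * n ∣                            ≡⟨ *-distribʳ-∣-∣ n (a / n) (b / n) ⟨
  ∣ a / n - b / n ∣ * n                                ∎)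
  where open ≡-Reasoning

≤∧∣⇒%≡ : ∀ {a b} n .{{_ : NonZero n}} → a ≤ b → n ∣ ∣ a - b ∣ → a % n ≡ b % n
≤∧∣⇒%≡ {a} {b} n a≤b n∣ = begin
  a % n                ≡⟨ %-remove-+ʳ a (subst (n ∣_) (m≤n⇒∣m-n∣≡n∸m a≤b) n∣) ⟨
  (a + (b ∸ a)) % n    ≡⟨ cong (_% n) (m+[n∸m]≡n a≤b) ⟩
  b % n                ∎
  where open ≡-Reasoning

∣⇒%≡ : ∀ a b n .{{_ : NonZero n}} → n ∣ ∣ a - b ∣ → a % n ≡ b % n
∣⇒%≡ a b n n∣ with ≤-total a b
... | inj₁ a≤b = ≤∧∣⇒%≡ n a≤b n∣
... | inj₂ b≤a = sym (≤∧∣⇒%≡ n b≤a (subst (n ∣_) (∣-∣-comm a b) n∣))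

%-cancelˡ-+ : ∀ c a b n .{{_ : NonZero n}} → (c + a) % n ≡ (c + b) % n → a % n ≡ b % n
%-cancelˡ-+ c a b n eq = ∣⇒%≡ a b n (subst (n ∣_) (∣m+n-m+o∣≡∣n-o∣ c a b) (%≡⇒∣ (c + a) (c + b) n eq))

%-cancelˡ-* : ∀ {c n} a b .{{_ : NonZero n}} → Coprime n c → (c * a) % n ≡ (c * b) % n → a % n ≡ b % n
%-cancelˡ-* {c} {n} a b cop eq =
  ∣⇒%≡ a b n (coprime-divisor cop (subst (n ∣_) (sym (*-distribˡ-∣-∣ c a b)) (%≡⇒∣ (c * a) (c * b) n eq)))

-- The factors `c` are cancelled one at a time, so coprimality to `c` itself suffices.
%-cancelˡ-^* : ∀ {c n} a b i .{{_ : NonZero n}} → Coprime n c → (c ^ i * a) % n ≡ (c ^ i * b) % n → a % n ≡ b % n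
%-cancelˡ-^* {c} {n} a b zero cop eq = begin
  a % n        ≡⟨ cong (_% n) (*-identityˡ a) ⟨
  (1 * a) % n  ≡⟨ eq ⟩
  (1 * b) % n  ≡⟨ cong (_% n) (*-identityˡ b) ⟩
  b % n        ∎
  where open ≡-Reasoning
%-cancelˡ-^* {c} {n} a b (suc i) cop eq = %-cancelˡ-^* a b i cop (%-cancelˡ-* (c ^ i * a) (c ^ i * b) cop (begin
  (c * (c ^ i * a)) % n  ≡⟨ cong (_% n) (*-assoc c (c ^ i) a) ⟨
  (c ^ suc i * a) % n    ≡⟨ eq ⟩
  (c ^ suc i * b) % n    ≡⟨ cong (_% n) (*-assoc c (c ^ i) b) ⟩
  (c * (c ^ i * b)) % n  ∎))
  where open ≡-Reasoning

%-injective-below : ∀ {a b n} .{{_ : NonZero n}} → a < n → b < n → a % n ≡ b % n → a ≡ b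
%-injective-below a<n b<n eq = trans (sym (m<n⇒m%n≡m a<n)) (trans eq (m<n⇒m%n≡m b<n))

%∧/-injective : ∀ {a b} n .{{_ : NonZero n}} → a % n ≡ b % n → a / n ≡ b / n → a ≡ b
%∧/-injective {a} {b} n r q =
  trans (m≡m%n+[m/n]*n a n) (trans (cong₂ (λ k l → k + l * n) r q) (sym (m≡m%n+[m/n]*n b n)))

-- Division with remainder and positional notation

euclidean-unique : ∀ {d d′ α α′ b} → d < b → d′ < b → d + α * b ≡ d′ + α′ * b → d ≡ d′ × α ≡ α′
euclidean-unique {d} {d′} {α} {α′} {b@(suc _)} d<b d′<b eq = d≡d′ , α≡α′
  where
  d≡d′ : d ≡ d′
  d≡d′ = %-injective-below d<b d′<b
    (trans (sym ([m+kn]%n≡m%n d α b)) (trans (cong (_% b) eq) ([m+kn]%n≡m%n d′ α′ b)))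

  α≡α′ : α ≡ α′
  α≡α′ = *-cancelʳ-≡ α α′ b (+-cancelˡ-≡ d (α * b) (α′ * b) (trans eq (cong (_+ α′ * b) (sym d≡d′))))

d+α*b<n*b : ∀ {d b α n} → d < b → α < n → d + α * b < n * b
d+α*b<n*b {d} {b} {α} {n} d<b α<n = begin-strict
  d + α * b  <⟨ +-monoˡ-< (α * b) d<b ⟩
  suc α * b  ≤⟨ *-monoˡ-≤ b α<n ⟩
  n * b      ∎
  where open ≤-Reasoning

-- The digit of index 0 is the most significant one.
horner : ℕ → (ℕ → ℕ) → ℕ → ℕ
horner b d zero    = 0
horner b d (suc s) = d s + horner b d s * b

horner-< : ∀ b d s → (∀ {i} → i < s → d i < b) → horner b d s < b ^ s
horner-< b d zero    d<b = z<s
horner-< b d (suc s) d<b = subst (horner b d (suc s) <_) (*-comm (b ^ s) b)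
  (d+α*b<n*b (d<b ≤-refl) (horner-< b d s (d<b ∘ m<n⇒m<1+n)))

horner-cong : ∀ b {d d′} s → (∀ {i} → i < s → d i ≡ d′ i) → horner b d s ≡ horner b d′ s
horner-cong b zero    d≡d′ = refl
horner-cong b (suc s) d≡d′ = cong₂ (λ k l → k + l * b) (d≡d′ ≤-refl) (horner-cong b s (d≡d′ ∘ m<n⇒m<1+n))

-- The least significant digit is the remainder modulo `b`; uniqueness of division splits it off,
-- and the quotient is handled by induction.
horner-injective : ∀ {b d d′} s → (∀ {i} → i < s → d i < b) → (∀ {i} → i < s → d′ i < b) →
                   horner b d s ≡ horner b d′ s → ∀ {i} → i < s → d i ≡ d′ i
horner-injective {b} {d} {d′} (suc s) d<b d′<b eq {i} i<1+s
  with ds≡ , hs≡ ← euclidean-unique {α = horner b d s} {horner b d′ s} (d<b ≤-refl) (d′<b ≤-refl) eq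
  with m≤n⇒m<n∨m≡n (s≤s⁻¹ i<1+s)
... | inj₁ i<s  = horner-injective s (d<b ∘ m<n⇒m<1+n) (d′<b ∘ m<n⇒m<1+n) hs≡ i<s
... | inj₂ refl = ds≡

-- Entries out of range are 0.
extend : ∀ {n} → Vector ℕ n → ℕ → ℕ
extend {zero}  f i       = 0
extend {suc n} f zero    = f zero
extend {suc n} f (suc i) = extend (f ∘ suc) i

extend-toℕ : ∀ {n} (f : Vector ℕ n) i → extend f (toℕ i) ≡ f i
extend-toℕ f zero    = refl
extend-toℕ f (suc i) = extend-toℕ (f ∘ suc) i

∀<⇐∀Fin : ∀ {n} (P : ℕ → Set) → (∀ (i : Fin n) → P (toℕ i)) → ∀ {i} → i < n → P i
∀<⇐∀Fin P h i<n = subst P (toℕ-fromℕ< i<n) (h (fromℕ< i<n))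

-- Finite counting

funToFin-cong : ∀ {m n} {f f′ : Fin m → Fin n} → (∀ i → f i ≡ f′ i) → funToFin f ≡ funToFin f′
funToFin-cong {zero}  f≡f′ = refl
funToFin-cong {suc m} f≡f′ = cong₂ combine (f≡f′ zero) (funToFin-cong (f≡f′ ∘ suc))

finToFun-injective : ∀ {m n} {c c′ : Fin (n ^ m)} → (∀ i → finToFun c i ≡ finToFun c′ i) → c ≡ c′
finToFun-injective {m} {n} {c} {c′} eq =
  trans (sym (funToFin-finToFin {m} {n} c)) (trans (funToFin-cong {m} {n} eq) (funToFin-finToFin {m} {n} c′))

remQuot-injective : ∀ {m} n {c c′ : Fin (m * n)} → remQuot {m} n c ≡ remQuot n c′ → c ≡ c′
remQuot-injective {m} n {c} {c′} eq =
  trans (sym (combine-remQuot {m} n c)) (trans (cong (uncurry combine) eq) (combine-remQuot {m} n c′))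

-- If `y` were missed, punching it out would inject `Fin (suc n)` into `Fin n`.
injective⇒strictlySurjective : ∀ {n} {f : Fin n → Fin n} → Injective _≡_ _≡_ f → ∀ y → ∃ λ x → f x ≡ y
injective⇒strictlySurjective {suc n} {f} inj y with any? (λ x → f x Fin.≟ y)
... | yes hit = hit
... | no miss = contradiction
  (injective⇒≤ {f = λ x → punchOut (y≢f x)} (λ eq → inj (punchOut-injective (y≢f _) (y≢f _) eq))) 1+n≰n
  where
  y≢f : ∀ x → ¬ (y ≡ f x)
  y≢f x y≡fx = miss (x , sym y≡fx)

injective⇒surjective-below : ∀ n (f : ℕ → ℕ) → (∀ {x} → x < n → f x < n) →
  (∀ {x x′} → x < n → x′ < n → f x ≡ f x′ → x ≡ x′) →
  ∀ {y} → y < n → ∃ λ x → x < n × f x ≡ y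
injective⇒surjective-below n f f<n inj {y} y<n
  with x , eq ← injective⇒strictlySurjective {f = λ x → fromℕ< (f<n (toℕ<n x))}
                  (λ {x} {x′} eq → toℕ-injective (inj (toℕ<n x) (toℕ<n x′) (fromℕ<-injective _ _ _ _ eq)))
                  (fromℕ< y<n)
  = toℕ x , toℕ<n x , fromℕ<-injective _ _ _ _ eq

-- Since `m` can be cancelled modulo `v`, the map `r ↦ (c + m * r) % v` is injective on the
-- residues, hence hits every one of them.
linear-congruence : ∀ {v m} .{{_ : NonZero v}} → Coprime v m → ∀ c b →
                    ∃ λ r → r < v × (c + m * r) % v ≡ b % v
linear-congruence {v} {m} cop c b = injective⇒surjective-below v (λ r → (c + m * r) % v)
  (λ {r} _ → m%n<n (c + m * r) v)
  (λ {r} {r′} r<v r′<v eq →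
    %-injective-below r<v r′<v (%-cancelˡ-* r r′ cop (%-cancelˡ-+ c (m * r) (m * r′) v eq)))
  (m%n<n b v)

lookup-injective : ∀ {A : Set} {xs : List A} → Unique xs → Injective _≡_ _≡_ (lookup xs)
lookup-injective {xs = x ∷ xs} (x∉xs ∷ u) {zero}  {zero}  eq = refl
lookup-injective {xs = x ∷ xs} (x∉xs ∷ u) {zero}  {suc j} eq = contradiction eq (All.lookup x∉xs (∈-lookup j))
lookup-injective {xs = x ∷ xs} (x∉xs ∷ u) {suc i} {zero}  eq = contradiction (sym eq) (All.lookup x∉xs (∈-lookup i))
lookup-injective {xs = x ∷ xs} (x∉xs ∷ u) {suc i} {suc j} eq = cong suc (lookup-injective u eq)

length-≤ : ∀ {A : Set} {xs : List A} {n} → Unique xs → (f : A → ℕ) → (∀ {x} → x ∈ xs → f x < n) →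
           (∀ {x x′} → x ∈ xs → x′ ∈ xs → f x ≡ f x′ → x ≡ x′) → length xs ≤ n
length-≤ u f f<n inj = injective⇒≤ {f = λ i → fromℕ< (f<n (∈-lookup i))}
  (λ {i} {j} eq → lookup-injective u (inj (∈-lookup i) (∈-lookup j) (fromℕ<-injective _ _ _ _ eq)))

≤-length : ∀ {A : Set} {xs : List A} {n} {f : Fin n → A} → Injective _≡_ _≡_ f → (∀ i → f i ∈ xs) → n ≤ length xs
≤-length {xs = xs} inj f∈xs = injective⇒≤ {f = λ i → index (f∈xs i)}
  (λ {i} {j} eq → inj (trans (lookup-index (f∈xs i)) (trans (cong (lookup xs) eq) (sym (lookup-index (f∈xs j))))))

-- Powers of a primitive root

module _ {p g : ℕ} .{{_ : NonZero p}} .{{_ : NonZero g}} (p-prime : Prime p) (g<p : g < p) (root : PrimitiveRoot p g) where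

  open HasOrder root

  private
    p⊥g : Coprime p g
    p⊥g = prime⇒coprime p-prime g<p

    1<p : 1 < p
    1<p = nonTrivial⇒n>1 p {{prime⇒nonTrivial p-prime}}

  -- From g^x · 1 ≡ 0 ≡ g^x · 0, cancelling the power would give 1 ≡ 0 modulo `p`.
  0<g^x%p : ∀ x → 0 < g ^ x % p
  0<g^x%p x = n≢0⇒n>0 λ g^x≡0 → contradiction
    (begin
      1      ≡⟨ m<n⇒m%n≡m 1<p ⟨
      1 % p  ≡⟨ %-cancelˡ-^* 1 0 x p⊥g (begin
        (g ^ x * 1) % p  ≡⟨ cong (_% p) (*-identityʳ (g ^ x)) ⟩
        g ^ x % p        ≡⟨ g^x≡0 ⟩
        0                ≡⟨ m<n⇒m%n≡m (>-nonZero⁻¹ p) ⟨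
        0 % p            ≡⟨ cong (_% p) (*-zeroʳ (g ^ x)) ⟨
        (g ^ x * 0) % p  ∎) ⟩
      0 % p  ≡⟨ m<n⇒m%n≡m (>-nonZero⁻¹ p) ⟩
      0      ∎) λ ()
    where open ≡-Reasoning

  -- Cancelling `g ^ x` leaves 1 ≡ g^(x′ - x) with a positive exponent below the order.
  power-≢ : ∀ {x x′} → x < x′ → x′ < p ∸ 1 → ¬ (g ^ x % p ≡ g ^ x′ % p)
  power-≢ {x} {x′} x<x′ x′<p-1 eq =
    minimal (m<n⇒0<n∸m x<x′) (≤-<-trans (m∸n≤m x′ x) x′<p-1)
      (sym (%-cancelˡ-^* 1 (g ^ (x′ ∸ x)) x p⊥g (begin
        (g ^ x * 1) % p               ≡⟨ cong (_% p) (*-identityʳ (g ^ x)) ⟩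
        g ^ x % p                     ≡⟨ eq ⟩
        g ^ x′ % p                    ≡⟨ cong (λ k → g ^ k % p) (m+[n∸m]≡n (<⇒≤ x<x′)) ⟨
        g ^ (x + (x′ ∸ x)) % p        ≡⟨ cong (_% p) (^-distribˡ-+-* g x (x′ ∸ x)) ⟩
        (g ^ x * g ^ (x′ ∸ x)) % p    ∎)))
    where open ≡-Reasoning

  power-injective : ∀ {x x′} → x < p ∸ 1 → x′ < p ∸ 1 → g ^ x % p ≡ g ^ x′ % p → x ≡ x′
  power-injective {x} {x′} x< x′< eq with <-cmp x x′
  ... | tri< x<x′ _ _ = contradiction eq (power-≢ x<x′ x′<)
  ... | tri≈ _ x≡x′ _ = x≡x′
  ... | tri> _ _ x′<x = contradiction (sym eq) (power-≢ x′<x x<)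

  -- The p - 1 powers are positive residues, so lowering each by one gives an injective self-map of
  -- the numbers below p - 1, which is then surjective.
  logarithm : ∀ {y} → 0 < y → y < p → ∃ λ x → x < p ∸ 1 × g ^ x % p ≡ y
  logarithm {suc y} _ 1+y<p
    with x , x< , eq ← injective⇒surjective-below (p ∸ 1) (λ x → g ^ x % p ∸ 1)
           (λ {x} _ → ∸-monoˡ-< (m%n<n (g ^ x) p) (0<g^x%p x))
           (λ {x} {x′} x< x′< eq → power-injective x< x′< (∸-cancelʳ-≡ (0<g^x%p x) (0<g^x%p x′) eq))
           (∸-monoˡ-< 1+y<p z<s)
    = x , x< , ∸-cancelʳ-≡ (0<g^x%p x) z<s eq

-- The multiplication orbit of y modulo p and the base g digits of y / p

module Orbit (p g : ℕ) .{{_ : NonZero p}} where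

  rem : ℕ → ℕ → ℕ
  rem y i = (g ^ i * y) % p

  digit : ℕ → ℕ → ℕ
  digit y i = g * rem y i / p

  digit<g : .{{_ : NonZero g}} → ∀ y i → digit y i < g
  digit<g y i = m<n*o⇒m/o<n (*-monoʳ-< g (m%n<n (g ^ i * y) p))

  rem-0 : ∀ {y} → y < p → rem y 0 ≡ y
  rem-0 {y} y<p = trans (cong (_% p) (*-identityˡ y)) (m<n⇒m%n≡m y<p)

  -- Starting the orbit at the residue of `g ^ x` turns the window of exponents from `x` onwards
  -- into the orbit indices from 0 onwards.
  rem-power : ∀ x i → rem (g ^ x % p) i ≡ g ^ (x + i) % p
  rem-power x i = begin
    (g ^ i * (g ^ x % p)) % p  ≡⟨ %-cong-* (g ^ i) (g ^ i) (g ^ x % p) (g ^ x) p refl (m%n%n≡m%n (g ^ x) p) ⟩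
    (g ^ i * g ^ x) % p        ≡⟨ cong (_% p) (^-distribˡ-+-* g i x) ⟨
    g ^ (i + x) % p            ≡⟨ cong (λ k → g ^ k % p) (+-comm i x) ⟩
    g ^ (x + i) % p            ∎
    where open ≡-Reasoning

  g*rem≡ : ∀ y i → g * rem y i ≡ rem y (suc i) + digit y i * p
  g*rem≡ y i = begin
    g * rem y i                              ≡⟨ m≡m%n+[m/n]*n (g * rem y i) p ⟩
    (g * rem y i) % p + digit y i * p        ≡⟨ cong (_+ digit y i * p) (begin
      (g * ((g ^ i * y) % p)) % p  ≡⟨ %-cong-* g g ((g ^ i * y) % p) (g ^ i * y) p refl (m%n%n≡m%n (g ^ i * y) p) ⟩
      (g * (g ^ i * y)) % p        ≡⟨ cong (_% p) (*-assoc g (g ^ i) y) ⟨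
      (g ^ suc i * y) % p          ∎) ⟩
    rem y (suc i) + digit y i * p            ∎
    where open ≡-Reasoning

  -- Long division: multiplying by `g` carries one more digit from the remainder into the quotient,
  -- so the quotient of g^i y by `p` is the number formed by the first `i` digits of y / p.
  g^i*y≡ : ∀ {y} → y < p → ∀ i → g ^ i * y ≡ rem y i + horner g (digit y) i * p
  g^i*y≡ {y} y<p zero = begin
    1 * y             ≡⟨ *-identityˡ y ⟩
    y                 ≡⟨ rem-0 y<p ⟨
    rem y 0           ≡⟨ +-identityʳ (rem y 0) ⟨
    rem y 0 + 0       ∎
    where open ≡-Reasoning
  g^i*y≡ {y} y<p (suc i) = begin
    g ^ suc i * y                                     ≡⟨ *-assoc g (g ^ i) y ⟩
    g * (g ^ i * y)                                   ≡⟨ cong (g *_) (g^i*y≡ y<p i) ⟩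
    g * (rem y i + h * p)                             ≡⟨ *-distribˡ-+ g (rem y i) (h * p) ⟩
    g * rem y i + g * (h * p)                         ≡⟨ cong (_+ g * (h * p)) (g*rem≡ y i) ⟩
    rem y (suc i) + digit y i * p + g * (h * p)       ≡⟨ regroup (rem y (suc i)) (digit y i) p g h ⟩
    rem y (suc i) + (digit y i + h * g) * p           ∎
    where
    open ≡-Reasoning
    h = horner g (digit y) i
    regroup : ∀ r d p g h → r + d * p + g * (h * p) ≡ r + (d + h * g) * p
    regroup = solve-∀

  -- Residue conditions on the orbit as congruences for the digits

  module Residues (v : ℕ) .{{_ : NonZero v}} (Z : ℕ → ℕ) where

    -- The bound is inclusive: `s + 1` orbit terms are prescribed, and the `s` transitions between
    -- them constrain `s` digits.
    HasResidues : ℕ → ℕ → Set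
    HasResidues s y = ∀ {i} → i ≤ s → rem y i % v ≡ Z i % v

    -- The relation `g*rem≡` read modulo `v`.
    digit-congruence : ∀ {s y} → HasResidues s y → ∀ {i} → i < s → (Z (suc i) + p * digit y i) % v ≡ (g * Z i) % v
    digit-congruence {s} {y} res {i} i<s = begin
      (Z (suc i) + p * digit y i) % v          ≡⟨ %-cong-+ (Z (suc i)) (rem y (suc i)) (p * digit y i) (digit y i * p) v
                                                    (sym (res i<s)) (cong (_% v) (*-comm p (digit y i))) ⟩
      (rem y (suc i) + digit y i * p) % v      ≡⟨ cong (_% v) (g*rem≡ y i) ⟨
      (g * rem y i) % v                        ≡⟨ %-cong-* g g (rem y i) (Z i) v refl (res (<⇒≤ i<s)) ⟩
      (g * Z i) % v                            ∎
      where open ≡-Reasoning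

    -- Induction along the orbit: modulo `v`, one term and its digit determine the next term.
    digit-congruence⁻¹ : ∀ {s y} → rem y 0 % v ≡ Z 0 % v →
                         (∀ {i} → i < s → (Z (suc i) + p * digit y i) % v ≡ (g * Z i) % v) → HasResidues s y
    digit-congruence⁻¹ z₀ h {zero}  _   = z₀
    digit-congruence⁻¹ {s} {y} z₀ h {suc i} i<s = %-cancelˡ-+ (p * digit y i) (rem y (suc i)) (Z (suc i)) v (begin
      (p * digit y i + rem y (suc i)) % v  ≡⟨ cong (_% v) (+-comm (p * digit y i) (rem y (suc i))) ⟩
      (rem y (suc i) + p * digit y i) % v  ≡⟨ cong (λ k → (rem y (suc i) + k) % v) (*-comm p (digit y i)) ⟩
      (rem y (suc i) + digit y i * p) % v  ≡⟨ cong (_% v) (g*rem≡ y i) ⟨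
      (g * rem y i) % v                    ≡⟨ %-cong-* g g (rem y i) (Z i) v refl (digit-congruence⁻¹ {s} {y} z₀ h (<⇒≤ i<s)) ⟩
      (g * Z i) % v                        ≡⟨ h i<s ⟨
      (Z (suc i) + p * digit y i) % v      ≡⟨ cong (_% v) (+-comm (Z (suc i)) (p * digit y i)) ⟩
      (p * digit y i + Z (suc i)) % v      ∎)
      where open ≡-Reasoning

    module Bounds .{{_ : NonZero g}} (v⊥p : Coprime v p) (s q r : ℕ)
                  (p≡ : p ≡ q * g ^ s + r) (r<g^s : r < g ^ s) where

      -- Upper bound: an injective code for the solutions

      private instance
        g^s≢0 : NonZero (g ^ s)
        g^s≢0 = m^n≢0 g s

      -- For y < p this is the integer part of g^s y / p.
      top : ℕ → ℕ
      top y = horner g (digit y) s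

      -- The left end of the interval to which the first `s` digits confine `y`: the least n with
      -- `top y * p ≤ n * g ^ s`.
      bottom : ℕ → ℕ
      bottom y = ⌈ top y * p / g ^ s ⌉

      -- The offset y ∸ bottom y and the digits of y are known modulo v, so that their quotients by v determine y.
      code : ℕ → ℕ
      code y = (y ∸ bottom y) / v + horner ⌈ g / v ⌉ (λ i → digit y i / v) s * (q / v + 1)

      module _ {y} (y<p : y < p) where

        bottom≤ : bottom y ≤ y
        bottom≤ = ⌈m/n⌉-least (top y * p) (g ^ s) y (begin
          top y * p                  ≤⟨ m≤n+m (top y * p) (rem y s) ⟩
          rem y s + top y * p        ≡⟨ g^i*y≡ y<p s ⟨
          g ^ s * y                  ≡⟨ *-comm (g ^ s) y ⟩
          y * g ^ s                  ∎)
          where open ≤-Reasoning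

        -- Scaled by g^s, the offset is at most the remainder `rem y s`, which is below p < (q + 1)
        -- g^s.
        y∸bottom≤q : y ∸ bottom y ≤ q
        y∸bottom≤q = s≤s⁻¹ (*-cancelʳ-< (g ^ s) (y ∸ bottom y) (suc q) (begin-strict
          (y ∸ bottom y) * g ^ s              ≡⟨ *-distribʳ-∸ (g ^ s) y (bottom y) ⟩
          y * g ^ s ∸ bottom y * g ^ s        ≤⟨ ∸-monoʳ-≤ (y * g ^ s) (m≤⌈m/n⌉*n (top y * p) (g ^ s)) ⟩
          y * g ^ s ∸ top y * p             ≡⟨ cong (_∸ top y * p) (trans (*-comm y (g ^ s)) (g^i*y≡ y<p s)) ⟩
          rem y s + top y * p ∸ top y * p   ≡⟨ m+n∸n≡m (rem y s) (top y * p) ⟩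
          rem y s                           <⟨ m%n<n (g ^ s * y) p ⟩
          p                                 ≡⟨ p≡ ⟩
          q * g ^ s + r                     <⟨ +-monoʳ-< (q * g ^ s) r<g^s ⟩
          q * g ^ s + g ^ s                 ≡⟨ +-comm (q * g ^ s) (g ^ s) ⟩
          suc q * g ^ s                     ∎))
          where open ≤-Reasoning

        offset< : (y ∸ bottom y) / v < q / v + 1
        offset< = subst ((y ∸ bottom y) / v <_) (+-comm 1 (q / v)) (s≤s (/-monoˡ-≤ v y∸bottom≤q))

      digit/v< : ∀ y i → digit y i / v < ⌈ g / v ⌉
      digit/v< y i = m<n*o⇒m/o<n (<-≤-trans (digit<g y i) (m≤⌈m/n⌉*n g v))

      code-< : ∀ {y} → y < p → code y < ⌈ g / v ⌉ ^ s * (q / v + 1)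
      code-< {y} y<p = d+α*b<n*b (offset< y<p) (horner-< ⌈ g / v ⌉ (λ i → digit y i / v) s (λ {i} _ → digit/v< y i))

      -- Equal codes give equal quotients by `v`. The digits also agree modulo `v`, because `p`
      -- cancels in `digit-congruence`; so they are equal and `bottom` is common. Then the offsets
      -- agree modulo `v`, since `y` and `y′` both lie in the class of `Z 0`, and are equal too.
      code-injective : ∀ {y y′} → y < p → y′ < p → HasResidues s y → HasResidues s y′ → code y ≡ code y′ → y ≡ y′
      code-injective {y} {y′} y<p y′<p res res′ eq = begin
        y                              ≡⟨ m+[n∸m]≡n (bottom≤ y<p) ⟨
        bottom y + (y ∸ bottom y)      ≡⟨ cong₂ _+_ bottom≡ (%∧/-injective v offset%≡ offset/≡) ⟩
        bottom y′ + (y′ ∸ bottom y′)   ≡⟨ m+[n∸m]≡n (bottom≤ y′<p) ⟩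
        y′                             ∎
        where
        open ≡-Reasoning

        parts : (y ∸ bottom y) / v ≡ (y′ ∸ bottom y′) / v ×
                horner ⌈ g / v ⌉ (λ i → digit y i / v) s ≡ horner ⌈ g / v ⌉ (λ i → digit y′ i / v) s
        parts = euclidean-unique (offset< y<p) (offset< y′<p) eq

        offset/≡ = proj₁ parts

        digit≡ : ∀ {i} → i < s → digit y i ≡ digit y′ i
        digit≡ {i} i<s = %∧/-injective v
          (%-cancelˡ-* (digit y i) (digit y′ i) v⊥p (%-cancelˡ-+ (Z (suc i)) (p * digit y i) (p * digit y′ i) v
            (trans (digit-congruence {y = y} res i<s) (sym (digit-congruence {y = y′} res′ i<s)))))
          (horner-injective s (λ {i} _ → digit/v< y i) (λ {i} _ → digit/v< y′ i) (proj₂ parts) i<s)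

        bottom≡ : bottom y ≡ bottom y′
        bottom≡ = cong (λ h → ⌈ h * p / g ^ s ⌉) (horner-cong g s digit≡)

        y%≡ : y % v ≡ y′ % v
        y%≡ = begin
          y % v         ≡⟨ cong (_% v) (rem-0 y<p) ⟨
          rem y 0 % v   ≡⟨ trans (res z≤n) (sym (res′ z≤n)) ⟩
          rem y′ 0 % v  ≡⟨ cong (_% v) (rem-0 y′<p) ⟩
          y′ % v        ∎

        offset%≡ : (y ∸ bottom y) % v ≡ (y′ ∸ bottom y′) % v
        offset%≡ = %-cancelˡ-+ (bottom y) (y ∸ bottom y) (y′ ∸ bottom y′) v (begin
          (bottom y + (y ∸ bottom y)) % v      ≡⟨ cong (_% v) (m+[n∸m]≡n (bottom≤ y<p)) ⟩
          y % v                                ≡⟨ y%≡ ⟩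
          y′ % v                               ≡⟨ cong (_% v) (m+[n∸m]≡n (bottom≤ y′<p)) ⟨
          (bottom y′ + (y′ ∸ bottom y′)) % v   ≡⟨ cong (λ b → (b + (y′ ∸ bottom y′)) % v) bottom≡ ⟨
          (bottom y + (y′ ∸ bottom y′)) % v    ∎)

      -- Lower bound: construction of solutions from prescribed digits

      residue : ℕ → ℕ
      residue i = proj₁ (linear-congruence v⊥p (Z (suc i)) (g * Z i))

      residue<v : ∀ i → residue i < v
      residue<v i = proj₁ (proj₂ (linear-congruence v⊥p (Z (suc i)) (g * Z i)))

      residue-congruence : ∀ i → (Z (suc i) + p * residue i) % v ≡ (g * Z i) % v
      residue-congruence i = proj₂ (proj₂ (linear-congruence v⊥p (Z (suc i)) (g * Z i)))

      private
        v⊥1 : Coprime v 1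
        v⊥1 = Coprimality.sym (1-coprimeTo v)

      -- The distance from `c` up to the first number in the class of `Z 0` modulo `v`.
      shift : ℕ → ℕ
      shift c = proj₁ (linear-congruence v⊥1 c (Z 0))

      shift<v : ∀ c → shift c < v
      shift<v c = proj₁ (proj₂ (linear-congruence v⊥1 c (Z 0)))

      shift-congruence : ∀ c → (c + 1 * shift c) % v ≡ Z 0 % v
      shift-congruence c = proj₂ (proj₂ (linear-congruence v⊥1 c (Z 0)))

      floor : ℕ → ℕ
      floor h = h * p / g ^ s

      -- The numbers above h p / g^s in the class of `Z 0`, listed by `k`. Starting at the successor
      -- of the floor, rather than at the ceiling, keeps them positive even for h = 0, so that each
      -- is the residue of a power of `g`.
      candidate : ℕ → ℕ → ℕ
      candidate h k = suc (floor h) + (shift (suc (floor h)) + k * v)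

      candidate-injective : ∀ {h h′ k k′} → h ≡ h′ → candidate h k ≡ candidate h′ k′ → k ≡ k′
      candidate-injective {h} refl eq = proj₂ (euclidean-unique (shift<v c) (shift<v c) (+-cancelˡ-≡ c _ _ eq))
        where
        c = suc (floor h)

      candidate%v : ∀ h k → candidate h k % v ≡ Z 0 % v
      candidate%v h k = begin
        (c + (shift c + k * v)) % v   ≡⟨ cong (_% v) (+-assoc c (shift c) (k * v)) ⟨
        (c + shift c + k * v) % v     ≡⟨ [m+kn]%n≡m%n (c + shift c) k v ⟩
        (c + shift c) % v             ≡⟨ cong (λ d → (c + d) % v) (*-identityˡ (shift c)) ⟨
        (c + 1 * shift c) % v         ≡⟨ shift-congruence c ⟩
        Z 0 % v                       ∎
        where
        open ≡-Reasoning
        c = suc (floor h)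

      -- Equality would make v a divisor of p.
      g^s*v-multiple<p : ¬ (v ∣ p) → g ^ s * (q / v * v) < p
      g^s*v-multiple<p v∤p = ≤∧≢⇒<
        (begin
          g ^ s * (q / v * v)  ≤⟨ *-monoʳ-≤ (g ^ s) (m/n*n≤m q v) ⟩
          g ^ s * q            ≡⟨ *-comm (g ^ s) q ⟩
          q * g ^ s            ≤⟨ m≤m+n (q * g ^ s) r ⟩
          q * g ^ s + r        ≡⟨ p≡ ⟨
          p                    ∎)
        (λ eq → v∤p (divides (g ^ s * (q / v)) (trans (sym eq) (sym (*-assoc (g ^ s) (q / v) v)))))
        where open ≤-Reasoning

      module _ (v∤p : ¬ (v ∣ p)) {h k : ℕ} (k< : k < q / v) where

        private
          y = candidate h k
          e = shift (suc (floor h)) + k * v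
          β = (h * p) % g ^ s

          -- This will be the remainder of g^s y modulo `p`, with quotient `h`.
          ρ : ℕ
          ρ = g ^ s * suc e ∸ β

        ρ<p : ρ < p
        ρ<p = begin-strict
          g ^ s * suc e ∸ β     ≤⟨ m∸n≤m (g ^ s * suc e) β ⟩
          -- The strict bound on `e` is used in the form `suc e ≤ q / v * v`.
          g ^ s * suc e         ≤⟨ *-monoʳ-≤ (g ^ s) (d+α*b<n*b (shift<v (suc (floor h))) k<) ⟩
          g ^ s * (q / v * v)   <⟨ g^s*v-multiple<p v∤p ⟩
          p                     ∎
          where open ≤-Reasoning

        g^s*candidate≡ : g ^ s * y ≡ ρ + h * p
        g^s*candidate≡ = begin
          g ^ s * (suc (floor h) + e)             ≡⟨ regroup (g ^ s) (floor h) e ⟩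
          g ^ s * suc e + floor h * g ^ s         ≡⟨ cong (_+ floor h * g ^ s) (m∸n+n≡m β≤) ⟨
          ρ + β + floor h * g ^ s                 ≡⟨ +-assoc ρ β (floor h * g ^ s) ⟩
          ρ + (β + floor h * g ^ s)               ≡⟨ cong (ρ +_) (m≡m%n+[m/n]*n (h * p) (g ^ s)) ⟨
          ρ + h * p                               ∎
          where
          open ≡-Reasoning
          regroup : ∀ n f e → n * (suc f + e) ≡ n * suc e + f * n
          regroup = solve-∀
          β≤ : β ≤ g ^ s * suc e
          β≤ = ≤-trans (<⇒≤ (m%n<n (h * p) (g ^ s))) (m≤m*n (g ^ s) (suc e))

        candidate<p : h < g ^ s → y < p
        candidate<p h< = *-cancelˡ-< (g ^ s) y p
          (subst (_< g ^ s * p) (sym g^s*candidate≡) (d+α*b<n*b ρ<p h<))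

        -- Both equations divide g^s y by `p` with a remainder below `p`, so the quotients coincide.
        top-candidate : h < g ^ s → top y ≡ h
        top-candidate h< = sym (proj₂ (euclidean-unique ρ<p (m%n<n (g ^ s * y) p)
          (trans (sym g^s*candidate≡) (g^i*y≡ (candidate<p h<) s))))

      -- The member numbered `K i`, counting from 0, of the residue class required of digit `i`.
      prescribed : (ℕ → ℕ) → ℕ → ℕ
      prescribed K i = residue i + K i * v

      module _ (v∤p : ¬ (v ∣ p)) {K : ℕ → ℕ} (K< : ∀ {i} → i < s → K i < g / v) {k : ℕ} (k< : k < q / v) where

        private
          h = horner g (prescribed K) s
          y = candidate h k

        prescribed< : ∀ {i} → i < s → prescribed K i < g
        prescribed< {i} i<s = <-≤-trans (d+α*b<n*b (residue<v i) (K< i<s)) (m/n*n≤m g v)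

        prescribed-top< : h < g ^ s
        prescribed-top< = horner-< g (prescribed K) s prescribed<

        digit-candidate : ∀ {i} → i < s → digit y i ≡ prescribed K i
        digit-candidate = horner-injective s (λ {i} _ → digit<g y i) prescribed< (top-candidate v∤p k< prescribed-top<)

        candidate-residues : HasResidues s y
        candidate-residues = digit-congruence⁻¹ {s} {y}
          (trans (cong (_% v) (rem-0 (candidate<p v∤p k< prescribed-top<))) (candidate%v h k))
          λ {i} i<s → begin
            (Z (suc i) + p * digit y i) % v              ≡⟨ cong (λ d → (Z (suc i) + p * d) % v) (digit-candidate i<s) ⟩
            (Z (suc i) + p * (residue i + K i * v)) % v  ≡⟨ %-cong-+ (Z (suc i)) (Z (suc i))
                                                               (p * (residue i + K i * v)) (p * residue i) v refl
                                                               (%-cong-* p p (residue i + K i * v) (residue i) v refl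
                                                                 ([m+kn]%n≡m%n (residue i) (K i) v)) ⟩
            (Z (suc i) + p * residue i) % v              ≡⟨ residue-congruence i ⟩
            (g * Z i) % v                                ∎
          where open ≡-Reasoning

      -- The digits of the common value are the prescribed ones for both choices; dividing them by
      -- `v` recovers `K`. The interval is then the same, and the position in it recovers `k`.
      candidates-injective : ¬ (v ∣ p) → ∀ {K K′ k k′} →
        (∀ {i} → i < s → K i < g / v) → (∀ {i} → i < s → K′ i < g / v) → k < q / v → k′ < q / v →
        candidate (horner g (prescribed K) s) k ≡ candidate (horner g (prescribed K′) s) k′ →
        (∀ {i} → i < s → K i ≡ K′ i) × k ≡ k′
      candidates-injective v∤p {K} {K′} K< K′< k< k′< eq = K≡ , candidate-injective (horner-cong g s prescribed≡) eq
        where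
        prescribed≡ : ∀ {i} → i < s → prescribed K i ≡ prescribed K′ i
        prescribed≡ {i} i<s = trans (sym (digit-candidate v∤p K< k< i<s))
          (trans (cong (λ y → digit y i) eq) (digit-candidate v∤p K′< k′< i<s))

        K≡ : ∀ {i} → i < s → K i ≡ K′ i
        K≡ {i} i<s = proj₂ (euclidean-unique (residue<v i) (residue<v i) (prescribed≡ i<s))

-- Transfer of both bounds to the exponents

theorem8 : ∀ (p v g t q r : ℕ) .{{_ : NonZero p}} .{{_ : NonZero v}} →
    Prime p → ¬ (2 ∣ p) →
    1 < v → v < p ∸ 1 →
    2 ≤ g → g ≤ p ∸ 1 → PrimitiveRoot p g →
    1 ≤ t →
    p ≡ q * g ^ (t ∸ 1) + r → r < g ^ (t ∸ 1) →
    (z : Vector (Fin v) t) →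
    ((g / v) ^ (t ∸ 1) * (q / v) ≤ occurrences p v g z) ×
    (occurrences p v g z ≤ ⌈ g / v ⌉ ^ (t ∸ 1) * (q / v + 1))
theorem8 p v g (suc s) q r p-prime _ 1<v v<p-1 2≤g g≤p-1 root _ p≡ r<g^s z = lower , upper
  where
  instance
    g≢0 : NonZero g
    g≢0 = >-nonZero (<-trans z<s 2≤g)

  v<p : v < p
  v<p = <-≤-trans v<p-1 (m∸n≤m p 1)

  g<p : g < p
  g<p = ≤-<-trans g≤p-1 (∸-monoʳ-< {p} {1} {0} z<s (>-nonZero⁻¹ p))

  v⊥p : Coprime v p
  v⊥p = Coprimality.sym (prime⇒coprime p-prime v<p)

  v∤p : ¬ (v ∣ p)
  v∤p v∣p = <⇒≢ 1<v (sym (v⊥p (∣-refl , v∣p)))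

  Z : ℕ → ℕ
  Z = extend (toℕ ∘ z)

  open Orbit p g
  open Residues v Z
  open Bounds v⊥p s q r p≡ r<g^s

  Z%v : ∀ ι → Z (toℕ ι) % v ≡ toℕ (z ι)
  Z%v ι = trans (cong (_% v) (extend-toℕ (toℕ ∘ z) ι)) (m<n⇒m%n≡m (toℕ<n (z ι)))

  occurs⇒residues : ∀ {x} → OccursAt p v g z x → HasResidues s (g ^ x % p)
  occurs⇒residues {x} occ i≤s = ∀<⇐∀Fin {suc s} (λ i → rem (g ^ x % p) i % v ≡ Z i % v)
    (λ ι → trans (cong (_% v) (rem-power x (toℕ ι))) (trans (occ ι) (sym (Z%v ι)))) (s≤s i≤s)

  residues⇒occurs : ∀ {x} → HasResidues s (g ^ x % p) → OccursAt p v g z x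
  residues⇒occurs {x} res ι =
    trans (cong (_% v) (sym (rem-power x (toℕ ι)))) (trans (res (s≤s⁻¹ (toℕ<n ι))) (Z%v ι))

  -- An occurrence is determined by its power of `g` modulo `p`, and that power by its code.
  upper : occurrences p v g z ≤ ⌈ g / v ⌉ ^ s * (q / v + 1)
  upper = length-≤ (filter⁺ (occursAt? p v g z) (upTo⁺ (p ∸ 1))) (λ x → code (g ^ x % p))
    (λ {x} _ → code-< (m%n<n (g ^ x) p))
    λ {x} {x′} x∈ x′∈ eq →
      let x<  , occ  = ∈-filter⁻ (occursAt? p v g z) {xs = upTo (p ∸ 1)} x∈
          x′< , occ′ = ∈-filter⁻ (occursAt? p v g z) {xs = upTo (p ∸ 1)} x′∈
      in power-injective p-prime g<p root (∈-upTo⁻ x<) (∈-upTo⁻ x′<)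
           (code-injective (m%n<n (g ^ x) p) (m%n<n (g ^ x′) p) (occurs⇒residues {x} occ) (occurs⇒residues {x′} occ′) eq)

  -- The index `c` packs the `s` class positions `K` together with `k`; each such choice yields one
  -- solution `y`.
  module _ (c : Fin ((g / v) ^ s * (q / v))) where

    multiples : Vector ℕ s
    multiples ι = toℕ (finToFun {g / v} {s} (proj₁ (remQuot {(g / v) ^ s} (q / v) c)) ι)

    K : ℕ → ℕ
    K = extend multiples

    k : Fin (q / v)
    k = proj₂ (remQuot {(g / v) ^ s} (q / v) c)

    K< : ∀ {i} → i < s → K i < g / v
    K< = ∀<⇐∀Fin (λ i → K i < g / v) λ ι → subst (_< g / v) (sym (extend-toℕ multiples ι)) (toℕ<n _)

    y : ℕ
    y = candidate (horner g (prescribed K) s) (toℕ k)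

    log : ∃ λ x → x < p ∸ 1 × g ^ x % p ≡ y
    -- A candidate is a successor by definition, so `z<s` proves it positive.
    log = logarithm p-prime g<p root z<s (candidate<p v∤p (toℕ<n k) (prescribed-top< v∤p K< (toℕ<n k)))

  y-injective : ∀ {c c′} → y c ≡ y c′ → c ≡ c′
  y-injective {c} {c′} eq = remQuot-injective (q / v) (cong₂ _,_
    (finToFun-injective {s} {g / v} λ ι → toℕ-injective
      (trans (sym (extend-toℕ (multiples c) ι)) (trans (proj₁ parts (toℕ<n ι)) (extend-toℕ (multiples c′) ι))))
    (toℕ-injective (proj₂ parts)))
    where
    parts = candidates-injective v∤p (K< c) (K< c′) (toℕ<n (k c)) (toℕ<n (k c′)) eq

  -- Distinct indices give distinct candidates, hence distinct logarithms, and each logarithm is an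
  -- occurrence.
  lower : (g / v) ^ s * (q / v) ≤ occurrences p v g z
  lower = ≤-length {f = λ c → proj₁ (log c)}
    (λ {c} {c′} eq → y-injective
      (trans (sym (proj₂ (proj₂ (log c)))) (trans (cong (λ x → g ^ x % p) eq) (proj₂ (proj₂ (log c′))))))
    λ c → let x , x< , g^x≡y = log c in
      ∈-filter⁺ (occursAt? p v g z) (∈-upTo⁺ x<)
        (residues⇒occurs {x} (subst (HasResidues s) (sym g^x≡y) (candidate-residues v∤p (K< c) (toℕ<n (k c)))))
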